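{- Let $m,n$ be nonnegative integers with $(m,n)\neq(0,1)$ and $m+n\geq 1$, and let $k\geq 3$. Let $\mathcal{A}_k$ be the family of simple graphs with acyclic chromatic number at most $k$. Then $\chi_{(m,n)}(\mathcal{A}_k)=k(2m+n)^{k-1}$.
   Context: An $(m,n)$-colored mixed graph $G=(V,A\cup E)$ consists of a vertex set $V$, a set $A$ of arcs each colored with one of $m$ colors $\alpha_1,\dots,\alpha_m$, and a set $E$ of edges each colored with one of $n$ colors $\beta_1,\dots,\beta_n$, such that the underlying undirected graph (forgetting orientations and colors) is simple (each pair of vertices joined by at most one arc or edge, no loops). A colored homomorphism of $G=(V_1,A_1\cup E_1)$ to $H=(V_2,A_2\cup E_2)$ is a map $f:V_1\to V_2$ such that every arc $uv$ of $G$ is mapped to an arc $f(u)f(v)$ of $H$ of the same color and every edge $uv$ of $G$ is mapped to an edge $f(u)f(v)$ of $H$ of the same color. The $(m,n)$-colored mixed chromatic number $\chi_{(m,n)}(G)$ of an $(m,n)$-colored mixed graph $G$ is the minimum number of vertices of an $(m,n)$-colored mixed graph $H$ such that $G$ admits a colored homomorphism to $H$. For a simple undirected graph $G$, $\chi_{(m,n)}(G)$ is the maximum of $\chi_{(m,n)}(G')$ over all $(m,n)$-colored mixed graphs $G'$ whose underlying graph is $G$; for a family $\mathcal{F}$ of simple graphs, $\chi_{(m,n)}(\mathcal{F})$ is the supremum of $\chi_{(m,n)}(G)$ over $G\in\mathcal{F}$. A graph is $k$-acyclic colorable if its vertices can be properly colored with $k$ colors such that any two color classes induce a forest; the acyclic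 chromatic number is the least such $k$. -}

module Defs where

open import Data.Nat using (ℕ; zero; suc; _+_; _*_; _∸_; _^_; _≤_)
open import Data.Fin using (Fin; zero; suc; inject₁; fromℕ)
open import Data.Bool using (Bool; true; false)
open import Data.Product using (Σ; _×_; _,_)
open import Relation.Binary.PropositionalEquality using (_≡_; _≢_)
open import Relation.Nullary using (¬_)
open import Function.Definitions using (Injective)
import Data.Sum
import Data.Fin

record SimpleGraph : Set where
  field
    size  : ℕ
    adj   : Fin size → Fin size → Bool
    irrefl : ∀ i → adj i i ≡ false
    sym    : ∀ i j → adj i j ≡ adj j i
open SimpleGraph public

record Cycle (G : SimpleGraph) : Set where
  field
    len   : ℕ
    vert  : Fin (3 + len) → Fin (size G)
    inj   : Injective _≡_ _≡_ vert
    steps : ∀ (i : Fin (2 + len)) → adj G (vert (inject₁ i)) (vert (suc i)) ≡ true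
    close : adj G (vert (fromℕ (2 + len))) (vert zero) ≡ true
open Cycle public

record AcyclicColoring (G : SimpleGraph) (k : ℕ) : Set where
  field
    col    : Fin (size G) → Fin k
    proper : ∀ i j → adj G i j ≡ true → col i ≢ col j
    forest : ∀ (a b : Fin k) (C : Cycle G) →
             ¬ (∀ (t : Fin (3 + len C)) →
                  (col (vert C t) ≡ a) Data.Sum.⊎ (col (vert C t) ≡ b))
open AcyclicColoring public

AcyclicChromatic≤ : SimpleGraph → ℕ → Set
AcyclicChromatic≤ G k = Σ ℕ λ j → j ≤ k × AcyclicColoring G j

-- (m,n)-coloured mixed graphs.
-- The label of the ordered pair (i , j):
--   none   : no arc/edge between i and j
--   out c  : an arc i → j of colour α_c
--   inn c  : an arc j → i of colour α_c
--   edg c  : an edge ij of colour β_c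

data Adj (m n : ℕ) : Set where
  none : Adj m n
  out  : Fin m → Adj m n
  inn  : Fin m → Adj m n
  edg  : Fin n → Adj m n

flipAdj : ∀ {m n} → Adj m n → Adj m n
flipAdj none    = none
flipAdj (out c) = inn c
flipAdj (inn c) = out c
flipAdj (edg c) = edg c

isAdj : ∀ {m n} → Adj m n → Bool
isAdj none    = false
isAdj (out _) = true
isAdj (inn _) = true
isAdj (edg _) = true

record MixedGraph (m n : ℕ) : Set where
  field
    msize : ℕ
    label : Fin msize → Fin msize → Adj m n
    loopless : ∀ i → label i i ≡ none
    consistent : ∀ i j → label j i ≡ flipAdj (label i j)
open MixedGraph public

Hom : ∀ {m n} → MixedGraph m n → MixedGraph m n → Set
Hom G H = Σ (Fin (msize G) → Fin (msize H)) λ f →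
  ∀ i j → label G i j ≢ none → label H (f i) (f j) ≡ label G i j

record ColoringOf (m n : ℕ) (G : SimpleGraph) : Set where
  field
    mixed : MixedGraph m n
    sameV : msize mixed ≡ size G
    under : ∀ i j → isAdj (label mixed i j) ≡ adj G (Data.Fin.cast sameV i) (Data.Fin.cast sameV j)
open ColoringOf public

χ≤ : ∀ {m n} → MixedGraph m n → ℕ → Set
χ≤ {m} {n} G N = Σ (MixedGraph m n) λ H → msize H ≤ N × Hom G H

χ≥ : ∀ {m n} → MixedGraph m n → ℕ → Set
χ≥ {m} {n} G N = ∀ (H : MixedGraph m n) → Hom G H → N ≤ msize H

-- χ_(m,n)(A_k) = N, where A_k = graphs with acyclic chromatic number ≤ k.
-- Since values are natural numbers, the supremum equals N iff N bounds all
-- values and is attained.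
χFamily≡ : (m n k N : ℕ) → Set
χFamily≡ m n k N =
  (∀ (G : SimpleGraph) → AcyclicChromatic≤ G k →
     ∀ (G' : ColoringOf m n G) → χ≤ (mixed G') N)
  × Σ SimpleGraph λ G → AcyclicChromatic≤ G k ×
     Σ (ColoringOf m n G) λ G' → χ≥ (mixed G') N

{-# OPTIONS --safe #-}

-- Write p = 2m + n for the number of possible labels of an adjacent ordered pair.
--
-- Upper bound: take an acyclic colouring with k colours. Each pair of colour classes {i, j}
-- spans a forest, so peeling off leaves one finds X : V → ℤ/p such that X u + X v is the code of
-- the label of uv, read from its endpoint of smaller colour. Mapping u to its colour together
-- with its k ∸ 1 values X u is a homomorphism to a graph with k p^(k-1) vertices.
--
-- Lower bound: take one base vertex of each colour and, for each colour i and each word a of k ∸ 1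
-- labels, a vertex (i, a) of colour i joined to the base vertices of the other colours with the
-- labels a. Vertices (i, a), (i, b) with a ≠ b disagree on a common neighbour. For (i, a), (j, b)
-- with i ≠ j add a vertex of a third colour joined to them with two different labels. No two of
-- the k p^(k-1) vertices (i, a) can then be identified. The colouring is acyclic since the
-- neighbours of a vertex on the levels below it have distinct colours.

module Submission where

open import Defs renaming (sym to adj-sym)
open import Data.Bool using (Bool; _∧_; false; if_then_else_; true)
import Data.Bool.Properties as Bool
open import Data.Empty using (⊥-elim)
open import Data.Fin using (Fin; combine; finToFun; fromℕ; fromℕ<; funToFin; inject₁; punchIn; punchOut; remQuot; suc; toℕ; zero)
open import Data.Fin.Properties as Fin using (*↔×; +↔⊎; _<?_; _≟_; all?; any?; cast-is-id; finToFun-funToFin; funToFin-finToFin; injective⇒≤; punchIn-injective; punchIn-punchOut; punchInᵢ≢i; punchOut-cong; punchOut-punchIn; remQuot-combine; toℕ-fromℕ; toℕ-fromℕ<; toℕ-injective; toℕ-inject₁; toℕ<n)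
open import Data.Fin.Relation.Unary.Top using (view; ‵fromℕ; ‵inject₁)
open import Data.Nat using (>-nonZero; NonZero; _*_; _+_; _<_; _^_; _∸_; _≤_; suc; s≤s; zero; z≤n; ℕ)
open import Data.Nat.DivMod using (%-distribˡ-+; [m+n]%n≡m%n; _%_; _mod_; m%n%n≡m%n; m%n<n; m<n⇒m%n≡m)
import Data.Nat.Properties as ℕ
open import Data.Product using (_,_; _×_; map₂; proj₁; proj₂; Σ; ∃; ∃₂)
open import Data.Product.Function.NonDependent.Propositional using (_×-↔_)
open import Data.Product.Properties using (≡-dec)
open import Data.Sum using (_⊎_; inj₁; inj₂)
open import Data.Sum.Function.Propositional using (_⊎-↔_)
open import Data.Vec.Functional using (insertAt)
open import Data.Vec.Functional.Properties using (insertAt-lookup; insertAt-punchIn)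
open import Function using (Injection; Inverse; _↔_; _∘_)
open import Function.Construct.Composition using (_↔-∘_)
open import Function.Construct.Identity using (↔-id)
open import Function.Definitions using (Injective)
open import Function.Properties.Inverse using (↔⇒↣)
open import Relation.Binary.Definitions using (tri<; tri>; tri≈)
open import Relation.Binary.PropositionalEquality using (_≗_; _≡_; _≢_; cong; cong₂; module ≡-Reasoning; refl; subst; subst₂; sym; trans)
open import Relation.Nullary using (Dec; contradiction; does; no; yes; ¬_)
open import Relation.Nullary.Decidable using (_×-dec_; _→-dec_; _⊎-dec_; dec-false; dec-true; decidable-stable; ¬?)

-- Leaves in finite acyclic graphs

InjectiveBelow : ∀ {n} → (ℕ → Fin n) → ℕ → Set
InjectiveBelow w T = ∀ {a b} → a < T → b < T → w a ≡ w b → a ≡ b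

-- Pigeonhole: `w` cannot be injective on `suc n` indices. The search stops at the earliest
-- collision, so all values before the second index are distinct, as the vertices of a cycle must
-- be. Writing that index as `suc d + i` exposes the gap for matching.
first-repetition : ∀ {n} (w : ℕ → Fin n) →
  ∃₂ λ i d → w i ≡ w (suc d + i) × InjectiveBelow w (suc d + i)
first-repetition {n} w with search (suc n)
  where
  search : ∀ T → (∃₂ λ i d → w i ≡ w (suc d + i) × InjectiveBelow w (suc d + i)) ⊎ InjectiveBelow w T
  search zero = inj₂ λ ()
  search (suc T) with search T
  ... | inj₁ found = inj₁ found
  ... | inj₂ inj with any? (λ (a : Fin T) → w (toℕ a) ≟ w T)
  ...   | yes (a , wa≡wT) with d , eq ← ℕ.m≤n⇒∃[o]m+o≡n (toℕ<n a)
        = inj₁ (toℕ a , d ,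
            subst (λ j → w (toℕ a) ≡ w j × InjectiveBelow w j)
              (sym (trans (cong suc (ℕ.+-comm d (toℕ a))) eq)) (wa≡wT , inj))
  search (suc T) | inj₂ inj | no fresh = inj₂ extend
    where
    fresh′ : ∀ {a} → a < T → w a ≢ w T
    fresh′ a<T wa≡wT = fresh (fromℕ< a<T , trans (cong w (Fin.toℕ-fromℕ< a<T)) wa≡wT)
    extend : InjectiveBelow w (suc T)
    extend a≤T b≤T wa≡wb with ℕ.m<1+n⇒m<n∨m≡n a≤T | ℕ.m<1+n⇒m<n∨m≡n b≤T
    ... | inj₁ a<T  | inj₁ b<T  = inj a<T b<T wa≡wb
    ... | inj₁ a<T  | inj₂ refl = contradiction wa≡wb (fresh′ a<T)
    ... | inj₂ refl | inj₁ b<T  = contradiction (sym wa≡wb) (fresh′ b<T)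
    ... | inj₂ refl | inj₂ refl = refl
... | inj₁ found = found
... | inj₂ inj = contradiction (injective⇒≤ restriction-injective) ℕ.1+n≰n
  where
  restriction-injective : Injective _≡_ _≡_ (λ (t : Fin (suc n)) → w (toℕ t))
  restriction-injective eq = toℕ-injective (inj (toℕ<n _) (toℕ<n _) eq)

-- Vertices of degree at most one, isolated vertices included.
Leaf : (G : SimpleGraph) → Fin (size G) → Set
Leaf G v = ∀ x y → adj G v x ≡ true → adj G v y ≡ true → x ≡ y

leaf? : ∀ G v → Dec (Leaf G v)
leaf? G v = all? λ x → all? λ y →
  (adj G v x Bool.≟ true) →-dec ((adj G v y Bool.≟ true) →-dec (x ≟ y))

non-leaf⇒other-neighbour : ∀ G {v} → ¬ Leaf G v → ∀ x → ∃ λ y → y ≢ x × adj G v y ≡ true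
non-leaf⇒other-neighbour G {v} ¬leaf x
  with any? (λ y → ¬? (y ≟ x) ×-dec (adj G v y Bool.≟ true))
... | yes found = found
... | no absent = contradiction leaf ¬leaf
  where
  unique : ∀ y → adj G v y ≡ true → y ≡ x
  unique y vy = decidable-stable (y ≟ x) λ y≢x → absent (y , y≢x , vy)
  leaf : Leaf G v
  leaf y z vy vz = trans (unique y vy) (sym (unique z vz))

-- A non-backtracking walk closes up a cycle at its first repeated vertex.
acyclic⇒leaf : ∀ G → Fin (size G) → ¬ Cycle G → ∃ (Leaf G)
acyclic⇒leaf G start acyclic with any? (leaf? G)
... | yes found = found
... | no absent = ⊥-elim (no-repetition (first-repetition walk))
  where
  step : ∀ v x → ∃ λ y → y ≢ x × adj G v y ≡ true
  step v = non-leaf⇒other-neighbour G λ leaf → absent (v , leaf)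
  walk : ℕ → Fin (size G)
  walk 0 = start
  -- The first step has no predecessor to avoid; avoiding `start` excludes nothing, since no vertex
  -- is adjacent to itself.
  walk 1 = proj₁ (step start start)
  walk (suc (suc t)) = proj₁ (step (walk (suc t)) (walk t))
  walk-adj : ∀ t → adj G (walk t) (walk (suc t)) ≡ true
  walk-adj zero = proj₂ (proj₂ (step start start))
  walk-adj (suc t) = proj₂ (proj₂ (step (walk (suc t)) (walk t)))
  no-repetition : ¬ ∃₂ λ i d → walk i ≡ walk (suc d + i) × InjectiveBelow walk (suc d + i)
  -- A gap of 1 would be a loop and a gap of 2 a step back to the previous vertex; a gap of `3 + l`
  -- closes up a cycle on that many vertices.
  no-repetition (i , 0 , eq , _)
    with () ← trans (sym (irrefl G (walk i))) (trans (cong (adj G (walk i)) eq) (walk-adj i))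
  no-repetition (i , 1 , eq , _) = proj₁ (proj₂ (step (walk (suc i)) (walk i))) (sym eq)
  no-repetition (i , suc (suc l) , eq , inj) = acyclic record
    { len = l
    ; vert = λ t → walk (toℕ t + i)
    ; inj = λ {a} {b} e → toℕ-injective
        (ℕ.+-cancelʳ-≡ i _ _ (inj (ℕ.+-monoˡ-< i (toℕ<n a)) (ℕ.+-monoˡ-< i (toℕ<n b)) e))
    ; steps = λ t → subst (λ s → adj G (walk (s + i)) (walk (suc (toℕ t) + i)) ≡ true)
        (sym (toℕ-inject₁ t)) (walk-adj (toℕ t + i))
    ; close = subst₂ (λ s x → adj G (walk (s + i)) x ≡ true)
        (sym (toℕ-fromℕ (2 + l))) (sym eq) (walk-adj (2 + l + i))
    }

-- Solving edge constraints on a forest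

induced : (G : SimpleGraph) {n : ℕ} → (Fin n → Fin (size G)) → SimpleGraph
induced G {n} f = record
  { size = n
  ; adj = λ i j → adj G (f i) (f j)
  ; irrefl = λ i → irrefl G (f i)
  ; sym = λ i j → adj-sym G (f i) (f j)
  }

induced-cycle : ∀ G {n} {f : Fin n → Fin (size G)} → Injective _≡_ _≡_ f → Cycle (induced G f) → Cycle G
induced-cycle G {f = f} f-inj C = record
  { len = len C
  ; vert = f ∘ vert C
  ; inj = inj C ∘ f-inj
  ; steps = steps C
  ; close = close C
  }

-- Induction on the number of vertices: delete a leaf, label the rest, and put the leaf back. It has
-- at most one constraint, which `R-total` solves starting from its neighbour.
forest-labelling : ∀ {A : Set} n (G : SimpleGraph) → size G ≡ n → ¬ Cycle G → A →
  (R : Fin (size G) → Fin (size G) → A → A → Set) →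
  (∀ {u v x y} → adj G u v ≡ true → R u v x y → R v u y x) →
  (∀ {u v} → adj G u v ≡ true → ∀ x → ∃ λ y → R u v x y) →
  ∃ λ (X : Fin (size G) → A) → ∀ u v → adj G u v ≡ true → R u v (X u) (X v)
forest-labelling zero record{} refl acyclic a R R-sym R-total = (λ ()) , λ ()
forest-labelling {A} (suc n) G@record{} refl acyclic a R R-sym R-total
  with v , leaf ← acyclic⇒leaf G zero acyclic
  with X , X-ok ← forest-labelling n (induced G (punchIn v)) refl
         (acyclic ∘ induced-cycle G (λ {i} {j} → punchIn-injective v i j))
         a (λ i j → R (punchIn v i) (punchIn v j)) R-sym R-total
  = X′ , X′-ok
  where
  value : ∃ λ z → ∀ i → adj G v (punchIn v i) ≡ true → R v (punchIn v i) z (X i)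
  value with any? (λ i → adj G v (punchIn v i) Bool.≟ true)
  -- An isolated vertex is subject to no constraint, so the default `a` will do.
  ... | no isolated = a , λ i vi → contradiction (i , vi) isolated
  ... | yes (i , vi) with iv ← trans (adj-sym G _ _) vi with z , r ← R-total iv (X i) = z , check
    where
    check : ∀ j → adj G v (punchIn v j) ≡ true → R v (punchIn v j) z (X j)
    check j vj with refl ← punchIn-injective v i j (leaf _ _ vi vj) = R-sym iv r
  X′ : Fin (suc n) → A
  X′ = insertAt X v (proj₁ value)
  data Split : Fin (suc n) → Set where
    leaf-vertex : Split v
    other-vertex : ∀ i → Split (punchIn v i)
  split : ∀ u → Split u
  split u with v ≟ u
  ... | yes refl = leaf-vertex
  ... | no v≢u = subst Split (punchIn-punchOut v≢u) (other-vertex (punchOut v≢u))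
  X′-ok : ∀ u w → adj G u w ≡ true → R u w (X′ u) (X′ w)
  X′-ok u w uw with split u | split w
  ... | leaf-vertex | leaf-vertex with () ← trans (sym (irrefl G v)) uw
  ... | leaf-vertex | other-vertex j
    rewrite insertAt-lookup X v (proj₁ value) | insertAt-punchIn X v (proj₁ value) j = proj₂ value j uw
  ... | other-vertex i | leaf-vertex
    rewrite insertAt-lookup X v (proj₁ value) | insertAt-punchIn X v (proj₁ value) i
    = R-sym vi (proj₂ value i vi)
    where vi = trans (adj-sym G _ _) uw
  ... | other-vertex i | other-vertex j
    rewrite insertAt-punchIn X v (proj₁ value) i | insertAt-punchIn X v (proj₁ value) j = X-ok i j uw

-- Subgraphs spanned by two colour classes

-- All vertices are kept and only edges are dropped, so a labelling of the restriction is already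
-- indexed by the vertices of `G`.
restrict : (G : SimpleGraph) → (Fin (size G) → Bool) → SimpleGraph
restrict G P = record
  { size = size G
  ; adj = λ i j → adj G i j ∧ (P i ∧ P j)
  ; irrefl = λ i → cong (_∧ (P i ∧ P i)) (irrefl G i)
  ; sym = λ i j → cong₂ _∧_ (adj-sym G i j) (Bool.∧-comm (P i) (P j))
  }

restrict-cycle : ∀ G {P} → Cycle (restrict G P) → Cycle G
restrict-cycle G C = record
  { len = len C
  ; vert = vert C
  ; inj = inj C
  ; steps = λ t → Bool.∧-conicalˡ _ _ (steps C t)
  ; close = Bool.∧-conicalˡ _ _ (close C)
  }

-- Every vertex of a cycle is an end of one of its edges: the last vertex of the closing edge, any
-- other of the step that leaves it. Edges of the restriction have both ends in `P`.
restrict-cycle-inside : ∀ G {P} (C : Cycle (restrict G P)) t → P (vert C t) ≡ true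
restrict-cycle-inside G {P} C t with view t
... | ‵fromℕ = Bool.∧-conicalˡ _ _ (Bool.∧-conicalʳ (adj G _ _) _ (close C))
... | ‵inject₁ s = Bool.∧-conicalˡ _ _ (Bool.∧-conicalʳ (adj G _ _) _ (steps C s))

does-true : ∀ {P : Set} (P? : Dec P) → does P? ≡ true → P
does-true (yes p) _ = p

-- A cycle in the restriction to the colours `b` and `c` would be a bicoloured cycle of `G`, so the
-- restriction is a forest and can be labelled.
bicoloured-labelling : ∀ {A : Set} {G k} (K : AcyclicColoring G k) → A →
  (R : Fin (size G) → Fin (size G) → A → A → Set) →
  (∀ {u v x y} → adj G u v ≡ true → R u v x y → R v u y x) →
  (∀ {u v} → adj G u v ≡ true → ∀ x → ∃ λ y → R u v x y) →
  ∀ b c → ∃ λ (X : Fin (size G) → A) → ∀ u v → adj G u v ≡ true →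
    col K u ≡ b ⊎ col K u ≡ c → col K v ≡ b ⊎ col K v ≡ c → R u v (X u) (X v)
bicoloured-labelling {A} {G} K a R R-sym R-total b c = proj₁ labelling , λ u v uv u∈ v∈ →
  proj₂ labelling u v
    (cong₂ _∧_ uv (cong₂ _∧_ (dec-true (b-or-c? u) u∈) (dec-true (b-or-c? v) v∈)))
  where
  b-or-c? : ∀ u → Dec (col K u ≡ b ⊎ col K u ≡ c)
  b-or-c? u = (col K u ≟ b) ⊎-dec (col K u ≟ c)
  H = restrict G (does ∘ b-or-c?)
  labelling : ∃ λ (X : Fin (size G) → A) → ∀ u v → adj H u v ≡ true → R u v (X u) (X v)
  labelling = forest-labelling (size H) H refl
    (λ C → forest K b c (restrict-cycle G C)
       λ t → does-true (b-or-c? (vert C t)) (restrict-cycle-inside G C t))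
    a R (R-sym ∘ Bool.∧-conicalˡ _ _) (R-total ∘ Bool.∧-conicalˡ _ _)

-- Labels read from the smaller colour, and their codes

byOrder : ∀ {A : Set} {k} → Fin k → Fin k → A → A → A
byOrder b c x y = if does (b <? c) then x else y

byOrder-flip : ∀ {A : Set} {k} {b c : Fin k} → b ≢ c → (x y : A) → byOrder c b y x ≡ byOrder b c x y
byOrder-flip {b = b} {c} b≢c x y with Fin.<-cmp b c
... | tri< b<c _ c≮b rewrite dec-true (b <? c) b<c | dec-false (c <? b) c≮b = refl
... | tri≈ _ b≡c _ = contradiction b≡c b≢c
... | tri> b≮c _ c<b rewrite dec-false (b <? c) b≮c | dec-true (c <? b) c<b = refl

byOrder-elim : ∀ {A : Set} {k} (b c : Fin k) (P : A → Set) {x y : A} → P x → P y → P (byOrder b c x y)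
byOrder-elim b c P px py with does (b <? c)
... | true  = px
... | false = py

flipAdj-involutive : ∀ {m n} (x : Adj m n) → flipAdj (flipAdj x) ≡ x
flipAdj-involutive none = refl
flipAdj-involutive (out _) = refl
flipAdj-involutive (inn _) = refl
flipAdj-involutive (edg _) = refl

-- The label of a pair read from its endpoint of smaller colour.
orient : ∀ {k m n} → Fin k → Fin k → Adj m n → Adj m n
orient b c x = byOrder b c x (flipAdj x)

-- The oriented label depends on the edge alone and not on the endpoint from which it is read. It
-- can therefore be matched with a commutative sum.
orient-flip : ∀ {k m n} {b c : Fin k} → b ≢ c → (x : Adj m n) → orient c b (flipAdj x) ≡ orient b c x
orient-flip {b = b} {c} b≢c x =
  trans (cong (byOrder c b (flipAdj x)) (flipAdj-involutive x)) (byOrder-flip b≢c x (flipAdj x))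

-- Here the code is fixed and the viewpoint changes: one code gives mutually reversed labels at the
-- two ends, as consistency of the target requires.
flip-orient : ∀ {k m n} {b c : Fin k} → b ≢ c → (x : Adj m n) → orient c b x ≡ flipAdj (orient b c x)
flip-orient {b = b} {c} b≢c x with does (b <? c) | byOrder-flip b≢c (flipAdj x) x
... | true  | eq = eq
... | false | eq = trans eq (sym (flipAdj-involutive x))

orient-involutive : ∀ {k m n} (b c : Fin k) (x : Adj m n) → orient b c (orient b c x) ≡ x
orient-involutive b c x with does (b <? c)
... | true = refl
... | false = flipAdj-involutive x

isAdj⇒≢none : ∀ {m n} {x : Adj m n} → isAdj x ≡ true → x ≢ none
isAdj⇒≢none () refl

≢none⇒isAdj : ∀ {m n} {x : Adj m n} → x ≢ none → isAdj x ≡ true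
≢none⇒isAdj {x = none} x≢ = contradiction refl x≢
≢none⇒isAdj {x = out _} _ = refl
≢none⇒isAdj {x = inn _} _ = refl
≢none⇒isAdj {x = edg _} _ = refl

flipAdj-≢none : ∀ {m n} {x : Adj m n} → x ≢ none → flipAdj x ≢ none
flipAdj-≢none {x = x} x≢ eq = x≢ (trans (sym (flipAdj-involutive x)) (cong flipAdj eq))

orient-≢none : ∀ {k m n} (b c : Fin k) {x : Adj m n} → x ≢ none → orient b c x ≢ none
orient-≢none b c {x} x≢ with does (b <? c)
... | true = x≢
... | false = flipAdj-≢none x≢

-- The nesting follows `2 * m + n`, which unfolds to `(m + (m + 0)) + n`; hence the empty summand
-- `Fin 0`.
Colour : ℕ → ℕ → Set
Colour m n = (Fin m ⊎ (Fin m ⊎ Fin 0)) ⊎ Fin n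

colour↔ : ∀ {m n} → Fin (2 * m + n) ↔ Colour m n
colour↔ = (((↔-id _ ⊎-↔ +↔⊎) ↔-∘ +↔⊎) ⊎-↔ ↔-id _) ↔-∘ +↔⊎

fromColour : ∀ {m n} → Colour m n → Adj m n
fromColour (inj₁ (inj₁ c)) = out c
fromColour (inj₁ (inj₂ (inj₁ c))) = inn c
fromColour (inj₂ c) = edg c

fromColour-injective : ∀ {m n} → Injective _≡_ _≡_ (fromColour {m} {n})
fromColour-injective {x = inj₁ (inj₁ _)} {inj₁ (inj₁ _)} refl = refl
fromColour-injective {x = inj₁ (inj₁ _)} {inj₁ (inj₂ (inj₁ _))} ()
fromColour-injective {x = inj₁ (inj₁ _)} {inj₂ _} ()
fromColour-injective {x = inj₁ (inj₂ (inj₁ _))} {inj₁ (inj₁ _)} ()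
fromColour-injective {x = inj₁ (inj₂ (inj₁ _))} {inj₁ (inj₂ (inj₁ _))} refl = refl
fromColour-injective {x = inj₁ (inj₂ (inj₁ _))} {inj₂ _} ()
fromColour-injective {x = inj₂ _} {inj₁ (inj₁ _)} ()
fromColour-injective {x = inj₂ _} {inj₁ (inj₂ (inj₁ _))} ()
fromColour-injective {x = inj₂ _} {inj₂ _} refl = refl

↔-injective : ∀ {A B : Set} (e : A ↔ B) → Injective _≡_ _≡_ (Inverse.to e)
↔-injective e = Injection.injective (↔⇒↣ e)

lab : ∀ {m n} → Fin (2 * m + n) → Adj m n
lab = fromColour ∘ Inverse.to colour↔

lab-injective : ∀ {m n} → Injective _≡_ _≡_ (lab {m} {n})
lab-injective = ↔-injective colour↔ ∘ fromColour-injective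

lab-isAdj : ∀ {m n} c → isAdj (lab {m} {n} c) ≡ true
lab-isAdj {m} {n} c with Inverse.to (colour↔ {m} {n}) c
... | inj₁ (inj₁ _) = refl
... | inj₁ (inj₂ (inj₁ _)) = refl
... | inj₂ _ = refl

lab-surjective : ∀ {m n} {x : Adj m n} → x ≢ none → ∃ λ c → lab c ≡ x
lab-surjective {m} {n} {x} x≢ with colour x≢
  where
  colour : ∀ {x : Adj m n} → x ≢ none → ∃ λ c → fromColour c ≡ x
  colour {none} x≢ = contradiction refl x≢
  colour {out c} _ = inj₁ (inj₁ c) , refl
  colour {inn c} _ = inj₁ (inj₂ (inj₁ c)) , refl
  colour {edg c} _ = inj₂ c , refl
... | c , eq = Inverse.from colour↔ c , trans (cong fromColour (Inverse.strictlyInverseˡ colour↔ c)) eq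

-- Addition modulo `p`

module _ {p : ℕ} .{{_ : NonZero p}} where

  infixl 6 _⊕_

  _⊕_ : Fin p → Fin p → Fin p
  x ⊕ y = (toℕ x + toℕ y) mod p

  ⊕-comm : ∀ x y → x ⊕ y ≡ y ⊕ x
  ⊕-comm x y = cong (_mod p) (ℕ.+-comm (toℕ x) (toℕ y))

  ⊕-solve : ∀ x c → ∃ λ y → x ⊕ y ≡ c
  ⊕-solve x c = z mod p , toℕ-injective (begin
    toℕ (x ⊕ z mod p)             ≡⟨ toℕ-fromℕ< (m%n<n (toℕ x + toℕ (z mod p)) p) ⟩
    (toℕ x + toℕ (z mod p)) % p   ≡⟨ cong (λ r → (toℕ x + r) % p) (toℕ-fromℕ< (m%n<n z p)) ⟩
    (toℕ x + z % p) % p           ≡⟨ %-distribˡ-+ (toℕ x) (z % p) p ⟩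
    (toℕ x % p + z % p % p) % p   ≡⟨ cong (λ r → (toℕ x % p + r) % p) (m%n%n≡m%n z p) ⟩
    (toℕ x % p + z % p) % p       ≡⟨ %-distribˡ-+ (toℕ x) z p ⟨
    (toℕ x + z) % p               ≡⟨ cong (_% p) x+z≡c+p ⟩
    (toℕ c + p) % p               ≡⟨ [m+n]%n≡m%n (toℕ c) p ⟩
    toℕ c % p                     ≡⟨ m<n⇒m%n≡m (toℕ<n c) ⟩
    toℕ c                         ∎)
    where
    open ≡-Reasoning
    -- A representative of `c` minus `x` modulo `p`; the truncated subtraction is exact because
    -- `toℕ x < p`.
    z = toℕ c + (p ∸ toℕ x)
    x+z≡c+p : toℕ x + z ≡ toℕ c + p
    x+z≡c+p = trans (ℕ.+-comm (toℕ x) z) (trans (ℕ.+-assoc (toℕ c) _ _)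
      (cong (toℕ c +_) (ℕ.m∸n+n≡m (ℕ.<⇒≤ (toℕ<n x)))))

pullback : ∀ {m n s} {V : Set} (decode : Fin s → V) (ℓ : V → V → Adj m n) →
  (∀ u → ℓ u u ≡ none) → (∀ u v → ℓ v u ≡ flipAdj (ℓ u v)) → MixedGraph m n
pullback {s = s} decode ℓ ℓ-loopless ℓ-consistent = record
  { msize = s
  ; label = λ i j → ℓ (decode i) (decode j)
  ; loopless = λ i → ℓ-loopless (decode i)
  ; consistent = λ i j → ℓ-consistent (decode i) (decode j)
  }

-- The target graph of the upper bound

module Target (m n k : ℕ) .{{_ : NonZero (2 * m + n)}} where

  p : ℕ
  p = 2 * m + n

  -- In (i , a) the entry a t belongs to the colour punchIn i t.
  Vertex : Set
  Vertex = Fin (suc k) × (Fin k → Fin p)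

  -- The sum is symmetric in the two ends, so all asymmetry of the label comes from `orient`.
  ℓ : Vertex → Vertex → Adj m n
  ℓ (i , a) (j , b) with i ≟ j
  ... | yes _ = none
  ... | no i≢j = orient i j (lab (a (punchOut i≢j) ⊕ b (punchOut (i≢j ∘ sym))))

  ℓ-≢ : ∀ {i j} a b (i≢j : i ≢ j) →
    ℓ (i , a) (j , b) ≡ orient i j (lab (a (punchOut i≢j) ⊕ b (punchOut (i≢j ∘ sym))))
  ℓ-≢ {i} {j} a b i≢j with i ≟ j
  ... | yes i≡j = contradiction i≡j i≢j
  ... | no i≢j′ = cong₂ (λ s t → orient i j (lab (a s ⊕ b t))) (punchOut-cong i refl) (punchOut-cong j refl)

  ℓ-≡ : ∀ i a b → ℓ (i , a) (i , b) ≡ none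
  ℓ-≡ i a b with i ≟ i
  ... | yes _ = refl
  ... | no i≢i = contradiction refl i≢i

  ℓ-consistent : ∀ u v → ℓ v u ≡ flipAdj (ℓ u v)
  ℓ-consistent (i , a) (j , b) with i ≟ j
  ... | yes refl = ℓ-≡ i b a
  ... | no i≢j = begin
    ℓ (j , b) (i , a)               ≡⟨ ℓ-≢ b a (i≢j ∘ sym) ⟩
    orient j i (lab (b t ⊕ a s′))   ≡⟨ cong (λ r → orient j i (lab (b t ⊕ a r))) (punchOut-cong i refl) ⟩
    orient j i (lab (b t ⊕ a s))    ≡⟨ cong (orient j i ∘ lab) (⊕-comm (b t) (a s)) ⟩
    orient j i (lab (a s ⊕ b t))    ≡⟨ flip-orient i≢j _ ⟩
    flipAdj (orient i j (lab (a s ⊕ b t))) ∎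
    where
    open ≡-Reasoning
    s = punchOut i≢j
    s′ = punchOut (i≢j ∘ sym ∘ sym)
    t = punchOut (i≢j ∘ sym)

  decode : Fin (suc k * p ^ k) → Vertex
  decode = map₂ finToFun ∘ remQuot {suc k} (p ^ k)

  encode : Vertex → Fin (suc k * p ^ k)
  encode (i , a) = combine i (funToFin a)

  -- The word returned agrees with `a` only pointwise. This suffices, because a label inspects a
  -- single entry of each word.
  decode-encode : ∀ i a → decode (encode (i , a)) ≡ (i , finToFun (funToFin a))
  decode-encode i a = cong (map₂ finToFun) (remQuot-combine i (funToFin a))

  H : MixedGraph m n
  H = pullback decode ℓ (λ u → ℓ-≡ (proj₁ u) (proj₂ u) (proj₂ u)) ℓ-consistent

  label-H : ∀ {i j} a b (i≢j : i ≢ j) → label H (encode (i , a)) (encode (j , b)) ≡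
    orient i j (lab (a (punchOut i≢j) ⊕ b (punchOut (i≢j ∘ sym))))
  label-H {i} {j} a b i≢j =
    trans (cong₂ ℓ (decode-encode i a) (decode-encode j b))
      (trans (ℓ-≢ _ _ i≢j) (cong₂ (λ x y → orient i j (lab (x ⊕ y)))
        (finToFun-funToFin a _) (finToFun-funToFin b _)))

-- The homomorphism into the target graph

module Upper {m n k : ℕ} .{{_ : NonZero (2 * m + n)}} (G : SimpleGraph) (K : AcyclicColoring G (suc k))
  (M-label : Fin (size G) → Fin (size G) → Adj m n)
  (M-consistent : ∀ u v → M-label v u ≡ flipAdj (M-label u v))
  (M-adj : ∀ u v → isAdj (M-label u v) ≡ adj G u v) where

  open Target m n k

  R : Fin (size G) → Fin (size G) → Fin p → Fin p → Set
  R u v x y = lab (x ⊕ y) ≡ orient (col K u) (col K v) (M-label u v)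

  R-sym : ∀ {u v x y} → adj G u v ≡ true → R u v x y → R v u y x
  R-sym {u} {v} {x} {y} uv r = begin
    lab (y ⊕ x)                                        ≡⟨ cong lab (⊕-comm y x) ⟩
    lab (x ⊕ y)                                        ≡⟨ r ⟩
    orient (col K u) (col K v) (M-label u v)           ≡⟨ orient-flip (proper K u v uv) _ ⟨
    orient (col K v) (col K u) (flipAdj (M-label u v)) ≡⟨ cong (orient (col K v) (col K u)) (M-consistent u v) ⟨
    orient (col K v) (col K u) (M-label v u)           ∎
    where open ≡-Reasoning

  R-total : ∀ {u v} → adj G u v ≡ true → ∀ x → ∃ λ y → R u v x y
  R-total {u} {v} uv x
    with c , eq ← lab-surjective (orient-≢none (col K u) (col K v) (isAdj⇒≢none (trans (M-adj u v) uv)))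
    with y , x⊕y≡c ← ⊕-solve x c = y , trans (cong lab x⊕y≡c) eq

  labelling : ∀ b c → ∃ λ (X : Fin (size G) → Fin p) → ∀ u v → adj G u v ≡ true →
    col K u ≡ b ⊎ col K u ≡ c → col K v ≡ b ⊎ col K v ≡ c → R u v (X u) (X v)
  labelling = bicoloured-labelling K (0 mod p) R (λ {u} {v} {x} {y} → R-sym {u} {v} {x} {y}) R-total

  -- The labellings for `(b , c)` and `(c , b)` are found separately and may differ. Choosing by
  -- order makes both ends of an edge use the same one.
  X : Fin (suc k) → Fin (suc k) → Fin (size G) → Fin p
  X b c = byOrder b c (proj₁ (labelling b c)) (proj₁ (labelling c b))

  X-sym : ∀ {b c} → b ≢ c → X c b ≡ X b c
  X-sym b≢c = byOrder-flip b≢c _ _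

  X-ok : ∀ u v → adj G u v ≡ true → R u v (X (col K u) (col K v) u) (X (col K u) (col K v) v)
  X-ok u v uv = byOrder-elim (col K u) (col K v) (λ (F : Fin (size G) → Fin p) → R u v (F u) (F v))
    (proj₂ (labelling (col K u) (col K v)) u v uv (inj₁ refl) (inj₂ refl))
    (proj₂ (labelling (col K v) (col K u)) u v uv (inj₂ refl) (inj₁ refl))

  entries : Fin (size G) → Fin k → Fin p
  entries u t = X (col K u) (punchIn (col K u) t) u

  f : Fin (size G) → Fin (suc k * p ^ k)
  f u = encode (col K u , entries u)

  -- Each end looks up, under the colour of the other, its value in their common labelling. The sum
  -- is the code of the oriented label, and orienting once more restores the label itself.
  f-hom : ∀ u v → M-label u v ≢ none → label H (f u) (f v) ≡ M-label u v
  f-hom u v uv≢ = begin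
    label H (f u) (f v)
      ≡⟨ label-H (entries u) (entries v) i≢j ⟩
    orient i j (lab (entries u (punchOut i≢j) ⊕ entries v (punchOut (i≢j ∘ sym))))
      ≡⟨ cong₂ (λ x y → orient i j (lab (x ⊕ y)))
           (cong (λ c → X i c u) (punchIn-punchOut i≢j))
           (trans (cong (λ c → X j c v) (punchIn-punchOut (i≢j ∘ sym))) (cong (λ F → F v) (X-sym i≢j))) ⟩
    orient i j (lab (X i j u ⊕ X i j v))
      ≡⟨ cong (orient i j) (X-ok u v uv) ⟩
    orient i j (orient i j (M-label u v))
      ≡⟨ orient-involutive i j _ ⟩
    M-label u v ∎
    where
    open ≡-Reasoning
    i = col K u
    j = col K v
    uv = trans (sym (M-adj u v)) (≢none⇒isAdj uv≢)
    i≢j = proper K u v uv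

-- Graphs of the family may be coloured with fewer than `k` colours; their bound is no larger.
*-^-mono : ∀ p .{{_ : NonZero p}} {j k} → suc j ≤ k → suc j * p ^ j ≤ k * p ^ (k ∸ 1)
*-^-mono p {j} {suc k} (s≤s j≤k) = ℕ.*-mono-≤ (s≤s j≤k) (ℕ.^-monoʳ-≤ p j≤k)

upper-bound : ∀ m n k .{{_ : NonZero (2 * m + n)}} (G : SimpleGraph) → AcyclicChromatic≤ G k →
  (G' : ColoringOf m n G) → χ≤ (mixed G') (k * (2 * m + n) ^ (k ∸ 1))
upper-bound m n k G@record{} (j , j≤k , K) record { mixed = M@record{} ; sameV = refl ; under = under } = bound j j≤k K
  where
  bound : ∀ j → j ≤ k → AcyclicColoring G j → χ≤ M (k * (2 * m + n) ^ (k ∸ 1))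
  -- Without colours there are no vertices, and the empty graph is a target; `Target` itself has at
  -- least one colour.
  bound zero _ K =
    record { msize = 0 ; label = λ () ; loopless = λ () ; consistent = λ () } , z≤n , col K , λ u → contradiction (col K u) λ ()
  bound (suc j) j<k K = H , *-^-mono (2 * m + n) j<k , f , f-hom
    where
    open Target m n j using (H)
    open Upper G K (label M) (consistent M)
      (λ u v → trans (under u v) (cong₂ (adj G) (cast-is-id refl u) (cast-is-id refl v)))

-- Acyclic colourings from a ranking of the vertices

argmax : ∀ {n} (r : Fin (suc n) → ℕ) → ∃ λ t → ∀ s → r s ≤ r t
argmax {zero} r = zero , λ where zero → ℕ.≤-refl
argmax {suc n} r with t , max ← argmax (r ∘ suc) with ℕ.≤-total (r zero) (r (suc t))
... | inj₁ r0≤rt = suc t , λ where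
  zero → r0≤rt
  (suc s) → max s
... | inj₂ rt≤r0 = zero , λ where
  zero → ℕ.≤-refl
  (suc s) → ℕ.≤-trans (max s) rt≤r0

-- Predecessor and successor differ because a cycle has at least three vertices. The first and the
-- last vertex each use the closing edge.
cycle-neighbours : ∀ {G} (C : Cycle G) t → ∃₂ λ a b → a ≢ b ×
  adj G (vert C t) (vert C a) ≡ true × adj G (vert C t) (vert C b) ≡ true
cycle-neighbours {G} C zero =
  fromℕ (2 + len C) , suc zero , (λ ()) , trans (adj-sym G _ _) (close C) , steps C zero
cycle-neighbours {G} C (suc s) with view s
... | ‵fromℕ = inject₁ (fromℕ (1 + len C)) , zero , (λ ()) , trans (adj-sym G _ _) (steps C _) , close C
... | ‵inject₁ r = inject₁ (inject₁ r) , suc (suc r) , distinct , trans (adj-sym G _ _) (steps C _) , steps C (suc r)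
  where
  distinct : inject₁ (inject₁ r) ≢ suc (suc r)
  distinct eq = ℕ.m≢1+n+m (toℕ r) {1} (trans (sym (trans (toℕ-inject₁ (inject₁ r)) (toℕ-inject₁ r))) (cong toℕ eq))

-- On a bicoloured cycle the two neighbours of a vertex of maximal rank have the same colour.
ranked-colouring : ∀ {G k} (colour : Fin (size G) → Fin k) (rank : Fin (size G) → ℕ) →
  (∀ u v → adj G u v ≡ true → colour u ≢ colour v) →
  (∀ u x y → adj G u x ≡ true → adj G u y ≡ true → rank x ≤ rank u → rank y ≤ rank u →
    colour x ≡ colour y → x ≡ y) →
  AcyclicColoring G k
ranked-colouring {G} colour rank proper back = record
  { col = colour
  ; proper = proper
  ; forest = λ a b C C⊆ab → no-bicoloured-cycle C C⊆ab
  }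
  where
  third-equal : ∀ {A : Set} {a b x y z : A} → x ≡ a ⊎ x ≡ b → y ≡ a ⊎ y ≡ b → z ≡ a ⊎ z ≡ b →
    x ≢ y → x ≢ z → y ≡ z
  third-equal (inj₁ refl) (inj₁ refl) _ x≢y _ = contradiction refl x≢y
  third-equal (inj₁ refl) _ (inj₁ refl) _ x≢z = contradiction refl x≢z
  third-equal (inj₁ refl) (inj₂ refl) (inj₂ refl) _ _ = refl
  third-equal (inj₂ refl) (inj₂ refl) _ x≢y _ = contradiction refl x≢y
  third-equal (inj₂ refl) _ (inj₂ refl) _ x≢z = contradiction refl x≢z
  third-equal (inj₂ refl) (inj₁ refl) (inj₁ refl) _ _ = refl
  no-bicoloured-cycle : ∀ {a b} (C : Cycle G) →
    ¬ (∀ t → colour (vert C t) ≡ a ⊎ colour (vert C t) ≡ b)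
  no-bicoloured-cycle C C⊆ab
    with t , max ← argmax (rank ∘ vert C)
    with x , y , x≢y , tx , ty ← cycle-neighbours C t
    = x≢y (inj C (back _ _ _ tx ty (max x) (max y)
        (third-equal (C⊆ab t) (C⊆ab x) (C⊆ab y) (proper _ _ tx) (proper _ _ ty))))

-- Underlying graphs and auxiliary choices for the lower bound

isAdj-flip : ∀ {m n} (x : Adj m n) → isAdj (flipAdj x) ≡ isAdj x
isAdj-flip none = refl
isAdj-flip (out _) = refl
isAdj-flip (inn _) = refl
isAdj-flip (edg _) = refl

underlying : ∀ {m n} → MixedGraph m n → SimpleGraph
underlying M = record
  { size = msize M
  ; adj = λ i j → isAdj (label M i j)
  ; irrefl = λ i → cong isAdj (loopless M i)
  ; sym = λ i j → sym (trans (cong isAdj (consistent M i j)) (isAdj-flip (label M i j)))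
  }

self-colouring : ∀ {m n} (M : MixedGraph m n) → ColoringOf m n (underlying M)
self-colouring M = record
  { mixed = M
  ; sameV = refl
  ; under = λ i j → sym (cong₂ (λ i j → isAdj (label M i j)) (cast-is-id refl i) (cast-is-id refl j))
  }

funToFin-cong : ∀ {m n} {f g : Fin m → Fin n} → f ≗ g → funToFin f ≡ funToFin g
funToFin-cong {zero} f≗g = refl
funToFin-cong {suc m} f≗g = cong₂ combine (f≗g zero) (funToFin-cong (f≗g ∘ suc))

finToFun-injective : ∀ {m n} (x y : Fin (n ^ m)) → finToFun {n} {m} x ≗ finToFun y → x ≡ y
finToFun-injective {m} {n} x y eq = trans (sym (funToFin-finToFin {m} {n} x))
  (trans (funToFin-cong eq) (funToFin-finToFin {m} {n} y))

-- A colour avoiding both arguments, for the vertices that separate two colours. The hypothesis of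
-- at least three colours enters here.
third : ∀ {k} → Fin (3 + k) → Fin (3 + k) → Fin (3 + k)
third i j with i ≟ j
... | yes _ = punchIn i zero
... | no i≢j = punchIn i (punchIn (punchOut i≢j) zero)

third-≢ˡ : ∀ {k} (i j : Fin (3 + k)) → third i j ≢ i
third-≢ˡ i j with i ≟ j
... | yes _ = punchInᵢ≢i i _
... | no _ = punchInᵢ≢i i _

third-≢ʳ : ∀ {k} (i j : Fin (3 + k)) → third i j ≢ j
third-≢ʳ i j eq with i ≟ j
... | yes refl = punchInᵢ≢i i _ eq
... | no i≢j = punchInᵢ≢i (punchOut i≢j) zero
  (punchIn-injective i _ _ (trans eq (sym (punchIn-punchOut i≢j))))

-- The extremal graph

module Witness (m n k : ℕ) {c₁ c₂ : Fin (2 * m + n)} (c₁≢c₂ : c₁ ≢ c₂) where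

  p K N : ℕ
  p = 2 * m + n
  K = 3 + k
  N = K * p ^ (2 + k)

  Mid : Set
  Mid = Fin K × Fin (p ^ (2 + k))

  _≟ᴹ_ : (w w′ : Mid) → Dec (w ≡ w′)
  _≟ᴹ_ = ≡-dec _≟_ _≟_

  -- Three levels: one base vertex per colour, the vertices to be kept apart, and a top vertex for
  -- each ordered pair of these. Admitting all pairs keeps the set a sum of products, which is easy
  -- to enumerate.
  Vertex : Set
  Vertex = Fin K ⊎ (Mid ⊎ (Mid × Mid))

  pattern base i = inj₁ i
  pattern mid w = inj₂ (inj₁ w)
  pattern top w = inj₂ (inj₂ w)

  vertex↔ : Fin (K + (N + N * N)) ↔ Vertex
  vertex↔ = (↔-id _ ⊎-↔ ((*↔× ⊎-↔ ((*↔× ×-↔ *↔×) ↔-∘ *↔×)) ↔-∘ +↔⊎)) ↔-∘ +↔⊎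

  midBase : Mid → Fin K → Adj m n
  midBase (i , a) j with i ≟ j
  ... | yes _ = none
  ... | no i≢j = lab (finToFun {p} {2 + k} a (punchOut i≢j))

  -- A top vertex over two vertices of the same colour is isolated.
  midTop : Mid → Mid × Mid → Adj m n
  midTop w (w₁ , w₂) with proj₁ w₁ ≟ proj₁ w₂ | w ≟ᴹ w₁ | w ≟ᴹ w₂
  ... | yes _ | _     | _     = none
  ... | no _  | yes _ | _     = lab c₁
  ... | no _  | no _  | yes _ = lab c₂
  ... | no _  | no _  | no _  = none

  ℓ : Vertex → Vertex → Adj m n
  ℓ (mid w)  (base j) = midBase w j
  ℓ (base j) (mid w)  = flipAdj (midBase w j)
  ℓ (mid w)  (top z)  = midTop w z
  ℓ (top z)  (mid w)  = flipAdj (midTop w z)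
  ℓ (base _) (base _) = none
  ℓ (base _) (top _)  = none
  ℓ (mid _)  (mid _)  = none
  ℓ (top _)  (base _) = none
  ℓ (top _)  (top _)  = none

  ℓ-loopless : ∀ u → ℓ u u ≡ none
  ℓ-loopless (base _) = refl
  ℓ-loopless (mid _)  = refl
  ℓ-loopless (top _)  = refl

  ℓ-consistent : ∀ u v → ℓ v u ≡ flipAdj (ℓ u v)
  ℓ-consistent (mid _)  (base _) = refl
  ℓ-consistent (base j) (mid w)  = sym (flipAdj-involutive (midBase w j))
  ℓ-consistent (mid _)  (top _)  = refl
  ℓ-consistent (top z)  (mid w)  = sym (flipAdj-involutive (midTop w z))
  ℓ-consistent (base _) (base _) = refl
  ℓ-consistent (base _) (top _)  = refl
  ℓ-consistent (mid _)  (mid _)  = refl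
  ℓ-consistent (top _)  (base _) = refl
  ℓ-consistent (top _)  (top _)  = refl

  midBase-adj : ∀ w j → isAdj (midBase w j) ≡ true → proj₁ w ≢ j
  midBase-adj (i , a) j wj with i ≟ j
  midBase-adj (i , a) j () | yes _
  ... | no i≢j = i≢j

  midBase-punchIn : ∀ i a t → midBase (i , a) (punchIn i t) ≡ lab (finToFun {p} {2 + k} a t)
  midBase-punchIn i a t with i ≟ punchIn i t
  ... | yes eq = contradiction (sym eq) (punchInᵢ≢i i t)
  ... | no _ = cong (lab ∘ finToFun a) (trans (punchOut-cong i refl) (punchOut-punchIn i))

  midTop-adj : ∀ w w₁ w₂ → isAdj (midTop w (w₁ , w₂)) ≡ true →
    proj₁ w₁ ≢ proj₁ w₂ × (w ≡ w₁ ⊎ w ≡ w₂)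
  midTop-adj w w₁ w₂ e with proj₁ w₁ ≟ proj₁ w₂ | w ≟ᴹ w₁ | w ≟ᴹ w₂
  ... | no ≢ | yes eq | _      = ≢ , inj₁ eq
  ... | no ≢ | no _   | yes eq = ≢ , inj₂ eq
  midTop-adj w w₁ w₂ () | yes _ | _    | _
  midTop-adj w w₁ w₂ () | no _  | no _ | no _

  midTop-first : ∀ {w₁ w₂} → proj₁ w₁ ≢ proj₁ w₂ → midTop w₁ (w₁ , w₂) ≡ lab c₁
  midTop-first {w₁} {w₂} ≢ with proj₁ w₁ ≟ proj₁ w₂ | w₁ ≟ᴹ w₁ | w₁ ≟ᴹ w₂
  ... | yes eq | _      | _ = contradiction eq ≢
  ... | no _   | yes _  | _ = refl
  ... | no _   | no ≢w₁ | _ = contradiction refl ≢w₁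

  midTop-second : ∀ {w₁ w₂} → proj₁ w₁ ≢ proj₁ w₂ → midTop w₂ (w₁ , w₂) ≡ lab c₂
  midTop-second {w₁} {w₂} ≢ with proj₁ w₁ ≟ proj₁ w₂ | w₂ ≟ᴹ w₁ | w₂ ≟ᴹ w₂
  ... | yes eq | _      | _      = contradiction eq ≢
  -- `midTop` tests for the first component before the second, so `w₂` must be known to differ from
  -- `w₁`; their colours tell them apart.
  ... | no _   | yes eq | _      = contradiction (sym (cong proj₁ eq)) ≢
  ... | no _   | no _   | yes _  = refl
  ... | no _   | no _   | no ≢w₂ = contradiction refl ≢w₂

  colour : Vertex → Fin K
  colour (base i) = i
  colour (mid (i , _)) = i
  colour (top ((i , _) , (j , _))) = third i j

  rank : Vertex → ℕ
  rank (base _) = 0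
  rank (mid _)  = 1
  rank (top _)  = 2

  midTop-proper : ∀ w z → isAdj (midTop w z) ≡ true → proj₁ w ≢ colour (top z)
  midTop-proper w (w₁ , w₂) wz with proj₂ (midTop-adj w w₁ w₂ wz)
  ... | inj₁ refl = third-≢ˡ (proj₁ w₁) (proj₁ w₂) ∘ sym
  ... | inj₂ refl = third-≢ʳ (proj₁ w₁) (proj₁ w₂) ∘ sym

  ℓ-proper : ∀ u v → isAdj (ℓ u v) ≡ true → colour u ≢ colour v
  ℓ-proper (mid w)  (base j) uv = midBase-adj w j uv
  ℓ-proper (base j) (mid w)  uv = midBase-adj w j (trans (sym (isAdj-flip (midBase w j))) uv) ∘ sym
  ℓ-proper (mid w)  (top z)  uv = midTop-proper w z uv
  ℓ-proper (top z)  (mid w)  uv = midTop-proper w z (trans (sym (isAdj-flip (midTop w z))) uv) ∘ sym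

  midTop-back : ∀ z x y → isAdj (midTop x z) ≡ true → isAdj (midTop y z) ≡ true → proj₁ x ≡ proj₁ y → x ≡ y
  midTop-back (w₁ , w₂) x y xz yz eq with midTop-adj x w₁ w₂ xz | midTop-adj y w₁ w₂ yz
  ... | _ , inj₁ refl | _ , inj₁ refl = refl
  ... | ≢ , inj₁ refl | _ , inj₂ refl = contradiction eq ≢
  ... | ≢ , inj₂ refl | _ , inj₁ refl = contradiction (sym eq) ≢
  ... | _ , inj₂ refl | _ , inj₂ refl = refl

  -- Below a middle vertex lie only base vertices, one per colour. Below a top vertex lie at most
  -- its two middle vertices, and if it is not isolated these have different colours. Base vertices
  -- have no neighbours on their own level.
  ℓ-back : ∀ u x y → isAdj (ℓ u x) ≡ true → isAdj (ℓ u y) ≡ true → rank x ≤ rank u → rank y ≤ rank u →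
    colour x ≡ colour y → x ≡ y
  ℓ-back (mid _) (base _) (base _) _ _ _ _ refl = refl
  ℓ-back (mid _) (top _) _ _ _ (s≤s ()) _ _
  ℓ-back (mid _) (base _) (top _) _ _ _ (s≤s ()) _
  ℓ-back (top z) (mid x) (mid y) ux uy _ _ eq = cong (λ w → mid w) (midTop-back z x y
    (trans (sym (isAdj-flip (midTop x z))) ux) (trans (sym (isAdj-flip (midTop y z))) uy) eq)

  decode : Fin (K + (N + N * N)) → Vertex
  decode = Inverse.to vertex↔

  M : MixedGraph m n
  M = pullback decode ℓ ℓ-loopless ℓ-consistent

  colouring : AcyclicColoring (underlying M) K
  colouring = ranked-colouring (colour ∘ decode) (rank ∘ decode)
    (λ u v → ℓ-proper (decode u) (decode v))
    (λ u x y ux uy x≤ y≤ eq → ↔-injective vertex↔ (ℓ-back (decode u) (decode x) (decode y) ux uy x≤ y≤ eq))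

  module _ (H : MixedGraph m n) (hom : Hom M H) where

    g : Vertex → Fin (msize H)
    g = proj₁ hom ∘ Inverse.from vertex↔

    g-hom : ∀ u v → isAdj (ℓ u v) ≡ true → label H (g u) (g v) ≡ ℓ u v
    g-hom u v uv = trans (proj₂ hom _ _ (λ eq → isAdj⇒≢none uv (trans (sym decoded) eq))) decoded
      where
      decoded : ℓ (decode (Inverse.from vertex↔ u)) (decode (Inverse.from vertex↔ v)) ≡ ℓ u v
      decoded = cong₂ ℓ (Inverse.strictlyInverseˡ vertex↔ u) (Inverse.strictlyInverseˡ vertex↔ v)

    -- Both labels equal the label in `H` between the common image of `u` and `v` and the image of
    -- their common neighbour `x`.
    identified : ∀ u v x {c d} → g u ≡ g v → ℓ u x ≡ lab c → ℓ v x ≡ lab d → c ≡ d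
    identified u v x {c} {d} gu≡gv ux vx = lab-injective (begin
      lab c               ≡⟨ ux ⟨
      ℓ u x               ≡⟨ g-hom u x (trans (cong isAdj ux) (lab-isAdj c)) ⟨
      label H (g u) (g x) ≡⟨ cong (λ y → label H y (g x)) gu≡gv ⟩
      label H (g v) (g x) ≡⟨ g-hom v x (trans (cong isAdj vx) (lab-isAdj d)) ⟩
      ℓ v x               ≡⟨ vx ⟩
      lab d               ∎)
      where open ≡-Reasoning

    g∘mid-injective : Injective _≡_ _≡_ (g ∘ λ w → mid w)
    g∘mid-injective {i , a} {j , b} eq with i ≟ j
    -- Within one colour, the base vertices of the other colours compare the two words letter by
    -- letter.
    ... | yes refl = cong (i ,_) (finToFun-injective {2 + k} {p} a b
      λ t → identified (mid (i , a)) (mid (i , b)) (base (punchIn i t)) eq (midBase-punchIn i a t) (midBase-punchIn i b t))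
    ... | no i≢j = contradiction
      (identified (mid (i , a)) (mid (j , b)) (top ((i , a) , (j , b))) eq
        (midTop-first i≢j) (midTop-second i≢j)) c₁≢c₂

    N≤msize : N ≤ msize H
    -- Only the images of the middle vertices are counted; `g` may collapse base and top vertices.
    N≤msize = injective⇒≤ (↔-injective (*↔× {K}) ∘ g∘mid-injective)

-- The two bounds combined

lower-bound : ∀ m n k → 2 ≤ 2 * m + n → 3 ≤ k → Σ SimpleGraph λ G → AcyclicChromatic≤ G k ×
  Σ (ColoringOf m n G) λ G' → χ≥ (mixed G') (k * (2 * m + n) ^ (k ∸ 1))
lower-bound m n (suc (suc (suc k))) 2≤p (s≤s (s≤s (s≤s z≤n))) =
  underlying M , (3 + k , ℕ.≤-refl , colouring) , self-colouring M , N≤msize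
  where
  -- The labels with codes 0 and 1 serve as `c₁` and `c₂`.
  distinct : fromℕ< (ℕ.≤-trans (s≤s z≤n) 2≤p) ≢ fromℕ< 2≤p
  distinct eq with () ← trans (sym (toℕ-fromℕ< (ℕ.≤-trans (s≤s z≤n) 2≤p))) (trans (cong toℕ eq) (toℕ-fromℕ< 2≤p))
  open Witness m n k distinct

-- The excluded pairs (0,0) and (0,1) are exactly those with fewer than two labels; the top vertices
-- use two different ones.
2≤2m+n : ∀ m n → ¬ (m ≡ 0 × n ≡ 1) → 1 ≤ m + n → 2 ≤ 2 * m + n
2≤2m+n zero (suc zero) ≢01 _ = contradiction (refl , refl) ≢01
2≤2m+n zero (suc (suc n)) _ _ = s≤s (s≤s z≤n)
2≤2m+n (suc m) n _ _ = ℕ.m≤n⇒m≤n+o n (ℕ.*-monoʳ-≤ 2 (s≤s z≤n))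

theorem1 : ∀ (m n k : ℕ) → ¬ (m ≡ 0 × n ≡ 1) → 1 ≤ m + n → 3 ≤ k →
    χFamily≡ m n k (k * (2 * m + n) ^ (k ∸ 1))
theorem1 m n k ≢01 1≤m+n 3≤k =
  upper-bound m n k {{>-nonZero (ℕ.<⇒≤ 2≤p)}} , lower-bound m n k 2≤p 3≤k
  where
  2≤p = 2≤2m+n m n ≢01 1≤m+n
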